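{- Let $\mathcal{H}$ be a pseudohalfplane hypergraph on a finite totally ordered vertex set $V$ such that every pair of hyperedges of $\mathcal{H}$ has a common vertex. Then there exists a set of at most $3$ vertices of $V$ that intersects every hyperedge of $\mathcal{H}$.
   Context: A hypergraph $\mathcal{F}$ on a totally ordered finite vertex set $V$ (a family of subsets of $V$) is ABA-free if there are no two hyperedges $A,B\in\mathcal{F}$ and vertices $x<y<z$ with $x,z\in A\setminus B$ and $y\in B\setminus A$. For a family $\mathcal{F}$ of subsets of $V$ let $\bar{\mathcal{F}}=\{V\setminus F: F\in\mathcal{F}\}$. A hypergraph $\mathcal{H}$ on $V$ is a pseudohalfplane hypergraph if there exists an ABA-free hypergraph $\mathcal{F}$ on $V$ such that $\mathcal{H}\subseteq\mathcal{F}\cup\bar{\mathcal{F}}$. -}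

module Defs where

open import Data.Nat using (ℕ)
open import Data.Fin using (Fin; _<_)
open import Data.Fin.Subset using (Subset; _∈_; _∉_; ∁; Nonempty; _∩_)
open import Data.List using (List)
import Data.List.Membership.Propositional as L
open import Data.Product using (_×_; ∃-syntax)
open import Data.Sum using (_⊎_)
open import Relation.Nullary using (¬_)

-- Vertex set V = Fin n, totally ordered by the usual order on Fin.
-- A hypergraph on V is a finite list of subsets (hyperedges).

ABA-free : {n : ℕ} → List (Subset n) → Set
ABA-free {n} F =
  ∀ (A B : Subset n) → A L.∈ F → B L.∈ F →
  ∀ (x y z : Fin n) → x < y → y < z →
  ¬ ((x ∈ A × x ∉ B) × (z ∈ A × z ∉ B) × (y ∈ B × y ∉ A))

SubFamilyWithComplements : {n : ℕ} → List (Subset n) → List (Subset n) → Set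
SubFamilyWithComplements {n} H F =
  ∀ (E : Subset n) → E L.∈ H → E L.∈ F ⊎ (∃[ G ] (G L.∈ F × E ≡' ∁ G))
  where
  open import Relation.Binary.PropositionalEquality using () renaming (_≡_ to _≡'_)

IsPseudohalfplane : {n : ℕ} → List (Subset n) → Set
IsPseudohalfplane {n} H = ∃[ F ] (ABA-free F × SubFamilyWithComplements H F)

Intersecting : {n : ℕ} → List (Subset n) → Set
Intersecting {n} H = ∀ (A B : Subset n) → A L.∈ H → B L.∈ H → Nonempty (A ∩ B)

Hits : {n : ℕ} → Subset n → List (Subset n) → Set
Hits {n} S H = ∀ (E : Subset n) → E L.∈ H → Nonempty (S ∩ E)

{-# OPTIONS --safe #-}

-- Call a vertex v covered by a hyperedge B if v ∉ B while B has vertices on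
-- both sides of v; the vertices covered by no member of a family are its top
-- vertices (they play the role of the upper convex hull).  In an ABA-free
-- family every nonempty member contains a top vertex.
--
-- The first vertex f of V is one of the three points, so only hyperedges
-- avoiding f matter.  If they all contain the last vertex, two points suffice.
-- Otherwise, up to complementing the ABA-free family F, some member of H ∩ F
-- avoids both f and the last vertex.  Let U consist of the members of H ∩ F
-- avoiding f, let r′ be the least top vertex of U lying to the right of an
-- entire A ∈ U, and let r be the last top vertex before r′.  A member of U
-- missing both r and r′ would lie strictly between them and contain no top
-- vertex.  A hyperedge ∁ B (with B ∈ F) avoiding f contains r′: it meets A in
-- some v < r′, and f, r′ ∈ B ∖ A would form a forbidden pattern with
-- v ∈ A ∖ B.
module Submission where

open import Defs
open import Data.Nat using (ℕ; zero; suc; _≤_; z≤n; s≤s; _+_)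
import Data.Nat.Properties as ℕ
open import Data.Bool using (true; false)
import Data.Bool.Properties as Bool
open import Data.Fin as Fin using (Fin; _<_; _>_; fromℕ)
open import Data.Fin.Properties using (any?; _<?_; <-cmp; <-trans; ≤fromℕ; ≤∧≢⇒<)
open import Data.Fin.Induction using (<-wellFounded; >-wellFounded)
open import Data.Fin.Subset using (Subset; ∣_∣; _∈_; _∉_; ∁; Nonempty; _∩_; _∪_; ⁅_⁆; ⊥)
open import Data.Fin.Subset.Properties
  using (_∈?_; ∣⁅x⁆∣≡1; x∈⁅x⁆; x∈p∩q⁺; x∈p∩q⁻; x∈p∪q⁺; x∈∁p⇒x∉p; x∉∁p⇒x∈p; x∉p⇒x∈∁p
        ; ∪-∩-booleanAlgebra)
open import Algebra.Lattice.Properties.BooleanAlgebra using (¬-involutive)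
open import Data.List using (List; filter; map)
import Data.List.Relation.Unary.Any as Any
import Data.List.Membership.Propositional as L
import Data.List.Membership.Propositional.Properties as L
import Data.List.Membership.DecPropositional as DecMembership
open import Data.Product using (_×_; ∃-syntax; _,_; proj₁; proj₂)
open import Data.Sum using (_⊎_; inj₁; inj₂)
open import Data.Vec using ([]; _∷_)
import Data.Vec.Properties as Vec
open import Function using (_∘_; case_of_)
open import Induction.WellFounded using (WellFounded; Acc; acc)
open import Relation.Binary.Core using (Rel)
import Relation.Binary.Definitions as B
open import Relation.Binary.Definitions using (tri<; tri≈; tri>)
open import Relation.Binary.PropositionalEquality using (_≡_; _≢_; refl; sym)
open import Relation.Nullary using (¬_; Dec; yes; no; contradiction)
open import Relation.Nullary.Decidable using (_×-dec_; ¬?; decidable-stable)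
open import Relation.Unary using (Pred; Decidable)
open import Level using (0ℓ)

private
  variable
    n : ℕ

-- Stated for any well-founded relation, so that `least` and `greatest` are both instances.
minimal : {_≺_ : Rel (Fin n) 0ℓ} → WellFounded _≺_ → B.Decidable _≺_ →
  {P : Pred (Fin n) 0ℓ} → Decidable P → ∀ {i} → P i →
  ∃[ m ] (P m × ∀ j → j ≺ m → ¬ P j)
minimal {_≺_ = _≺_} wf _≺?_ {P} P? {i} Pi = go (wf i) Pi
  where
  go : ∀ {i} → Acc _≺_ i → P i → ∃[ m ] (P m × ∀ j → j ≺ m → ¬ P j)
  go {i} (acc rs) Pi with any? (λ j → (j ≺? i) ×-dec P? j)
  ... | yes (j , j≺i , Pj) = go (rs j≺i) Pj
  ... | no none = i , Pi , λ j j≺i Pj → none (j , j≺i , Pj)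

least : {P : Pred (Fin n) 0ℓ} → Decidable P → ∀ {i} → P i →
  ∃[ m ] (P m × ∀ j → j < m → ¬ P j)
least = minimal <-wellFounded _<?_

greatest : {P : Pred (Fin n) 0ℓ} → Decidable P → ∀ {i} → P i →
  ∃[ m ] (P m × ∀ j → j > m → ¬ P j)
greatest = minimal >-wellFounded (λ i j → j <? i)

-- Covered vertices and top vertices

Covers : Subset n → Fin n → Set
Covers B v = v ∉ B × (∃[ a ] (a < v × a ∈ B)) × (∃[ b ] (v < b × b ∈ B))

covers? : (v : Fin n) (B : Subset n) → Dec (Covers B v)
covers? v B = ¬? (v ∈? B) ×-dec any? (λ a → (a <? v) ×-dec (a ∈? B))
                          ×-dec any? (λ b → (v <? b) ×-dec (b ∈? B))

Top : List (Subset n) → Fin n → Set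
Top U v = ¬ Any.Any (λ B → Covers B v) U

top? : (U : List (Subset n)) → Decidable (Top U)
top? U v = ¬? (Any.any? (covers? v) U)

uncovered : ∀ {U : List (Subset n)} {B a v b} → Top U v → B L.∈ U →
  a < v → a ∈ B → v < b → b ∈ B → v ∈ B
uncovered {B = B} {v = v} top B∈U a<v a∈B v<b b∈B = decidable-stable (v ∈? B) λ v∉B →
  top (L.lose B∈U (v∉B , (_ , a<v , a∈B) , (_ , v<b , b∈B)))

-- Start at the first vertex u of A, and as long as u is covered by some B, move
-- to the next vertex of B.  Throughout, members covering u do not leave A to
-- the right of u.
member-contains-top : (U : List (Subset n)) → ABA-free U → ∀ {A} → A L.∈ U → Nonempty A →
  ∃[ t ] (t ∈ A × Top U t)
member-contains-top U aba {A} A∈U (_ , a∈A) with least (_∈? A) a∈A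
... | u₀ , u₀∈A , first = climb (>-wellFounded u₀) u₀∈A start
  where
  RightInside : Fin _ → Set
  RightInside u = ∀ C → C L.∈ U → Covers C u → ∀ c → c ∈ C → u < c → c ∈ A

  start : RightInside u₀
  start C C∈U (u∉C , (a , a<u , a∈C) , _) c c∈C u<c = decidable-stable (c ∈? A) λ c∉A →
    aba C A C∈U A∈U a u₀ c a<u u<c
      ((a∈C , first a a<u) , (c∈C , c∉A) , (u₀∈A , u∉C))

  climb : ∀ {u} → Acc _>_ u → u ∈ A → RightInside u → ∃[ t ] (t ∈ A × Top U t)
  climb {u} (acc rs) u∈A inside with Any.any? (covers? u) U
  ... | no top = u , u∈A , top
  ... | yes covered with L.find covered
  ... | B , B∈U , cov@(u∉B , _ , (_ , u<b₀ , b₀∈B))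
    with least (λ b → (u <? b) ×-dec (b ∈? B)) (u<b₀ , b₀∈B)
  ... | b , (u<b , b∈B) , next =
    climb (rs u<b) (inside B B∈U cov b b∈B u<b) inside′
    where
    inside′ : RightInside b
    inside′ C C∈U (b∉C , (x , x<b , x∈C) , _) c c∈C b<c =
      decidable-stable (c ∈? A) λ c∉A →
      let
        -- Since `c ∉ B`, ABA-freeness puts all vertices of `C` before `b` into `B`. As `B` has no
        -- vertex from `u` up to `b`, `C` already covers `u`.
        u<c = <-trans u<b b<c
        c∉B = λ c∈B → c∉A (inside B B∈U cov c c∈B u<c)
        C⊆B-before-b : ∀ y → y < b → y ∈ C → y ∈ B
        C⊆B-before-b y y<b y∈C = decidable-stable (y ∈? B) λ y∉B →
          aba C B C∈U B∈U y b c y<b b<c ((y∈C , y∉B) , (c∈C , c∉B) , (b∈B , b∉C))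
        x∈B = C⊆B-before-b x x<b x∈C
        x<u = case <-cmp x u of λ where
          (tri< x<u _ _)  → x<u
          (tri≈ _ refl _) → contradiction x∈B u∉B
          (tri> _ _ u<x)  → contradiction (u<x , x∈B) (next x x<b)
        u∉C = λ u∈C → u∉B (C⊆B-before-b u u<b u∈C)
      in c∉A (inside C C∈U (u∉C , (x , x<u , x∈C) , (c , u<c , c∈C)) c c∈C u<c)

-- Two consecutive top vertices as hitting points

zero≢⇒zero< : {i : Fin (suc n)} → Fin.zero ≢ i → Fin.zero {n} < i
zero≢⇒zero< = ≤∧≢⇒< z≤n

∈∉⇒≢ : ∀ {p : Subset n} {x y} → x ∈ p → y ∉ p → x ≢ y
∈∉⇒≢ x∈p y∉p refl = y∉p x∈p

LeftOf : Subset n → Fin n → Set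
LeftOf A r = ∀ x → x ∈ A → x < r

leftOf? : (A : Subset n) (r : Fin n) → Dec (LeftOf A r)
leftOf? A r with any? (λ x → (x ∈? A) ×-dec ¬? (x <? r))
... | yes (x , x∈A , x≮r) = no λ left → x≮r (left x x∈A)
... | no none = yes λ x x∈A → decidable-stable (x <? r) λ x≮r → none (x , x∈A , x≮r)

top-zero : (U : List (Subset (suc n))) → Top U Fin.zero
top-zero U covered with L.find covered
... | _ , _ , _ , (_ , () , _) , _

top-fromℕ : (U : List (Subset (suc n))) → Top U (fromℕ n)
top-fromℕ U covered with L.find covered
... | _ , _ , _ , _ , (b , last<b , _) = ℕ.<⇒≱ last<b (≤fromℕ b)

TopRightOfMember : List (Subset n) → Fin n → Set
TopRightOfMember U v = Top U v × Any.Any (λ A → LeftOf A v) U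

TopBefore : List (Subset n) → Fin n → Fin n → Set
TopBefore U r′ v = Top U v × v < r′

-- Suppose `C` misses both points. It meets `A` before `r′` and cannot jump over the uncovered `r′`,
-- so it ends before `r′`. Its top vertex is then before `r`, so `C` cannot jump over `r` either,
-- and `r` contradicts the choice of `r′`.
consecutive-tops-hit : (U : List (Subset n)) → ABA-free U → Intersecting U →
  ∀ {A r r′} → A L.∈ U → LeftOf A r′ →
  Top U r′ → (∀ v → v < r′ → ¬ TopRightOfMember U v) →
  TopBefore U r′ r → (∀ v → v > r → ¬ TopBefore U r′ v) →
  ∀ C → C L.∈ U → r ∈ C ⊎ r′ ∈ C
consecutive-tops-hit U aba int {A} {r} {r′} A∈U left top-r′ leastTop (top-r , r<r′) lastTop C C∈U
  with r ∈? C | r′ ∈? C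
... | yes r∈C | _ = inj₁ r∈C
... | no _ | yes r′∈C = inj₂ r′∈C
... | no r∉C | no r′∉C with int A C A∈U C∈U
... | v , v∈A∩C with x∈p∩q⁻ A C v∈A∩C
... | v∈A , v∈C with member-contains-top U aba C∈U (v , v∈C)
... | t , t∈C , top-t = contradiction (top-r , L.lose C∈U C-left-r) (leastTop r r<r′)
  where
  C-left-r′ : LeftOf C r′
  C-left-r′ x x∈C with <-cmp x r′
  ... | tri< x<r′ _ _ = x<r′
  ... | tri≈ _ x≡r′ _ = contradiction x≡r′ (∈∉⇒≢ x∈C r′∉C)
  ... | tri> _ _ r′<x = contradiction (uncovered top-r′ C∈U (left v v∈A) v∈C r′<x x∈C) r′∉C

  t<r : t < r
  t<r with <-cmp t r
  ... | tri< t<r _ _ = t<r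
  ... | tri≈ _ t≡r _ = contradiction t≡r (∈∉⇒≢ t∈C r∉C)
  ... | tri> _ _ r<t = contradiction (top-t , C-left-r′ t t∈C) (lastTop t r<t)

  C-left-r : LeftOf C r
  C-left-r x x∈C with <-cmp x r
  ... | tri< x<r _ _ = x<r
  ... | tri≈ _ x≡r _ = contradiction x≡r (∈∉⇒≢ x∈C r∉C)
  ... | tri> _ _ r<x = contradiction (uncovered top-r C∈U t<r t∈C r<x x∈C) r∉C

two-points : (U : List (Subset (suc n))) → ABA-free U → Intersecting U →
  ∀ {A₀} → A₀ L.∈ U → fromℕ n ∉ A₀ →
  ∃[ A ] ∃[ r ] ∃[ r′ ] (A L.∈ U × LeftOf A r′ × ∀ C → C L.∈ U → r ∈ C ⊎ r′ ∈ C)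
two-points {n} U aba int A₀∈U last∉A₀ =
  let
    r′ , (top-r′ , someLeft) , leastTop =
      least {P = TopRightOfMember U} (λ v → top? U v ×-dec Any.any? (λ A → leftOf? A v) U)
        -- The last vertex is a candidate for `r′`, because `A₀` avoids it.
        (top-fromℕ U , L.lose A₀∈U λ x x∈A₀ → ≤∧≢⇒< (≤fromℕ x) (∈∉⇒≢ x∈A₀ last∉A₀))
    A , A∈U , left = L.find someLeft
    -- Meeting itself makes `A` nonempty, so the first vertex lies before `r′` and is a candidate
    -- for `r`.
    x , x∈A∩A = int A A A∈U A∈U
    zero<r′ = ℕ.≤-<-trans z≤n (left x (proj₁ (x∈p∩q⁻ A A x∈A∩A)))
    r , before , lastTop =
      greatest {P = TopBefore U r′} (λ v → top? U v ×-dec (v <? r′))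
        {Fin.zero} (top-zero U , zero<r′)
  in A , r , r′ , A∈U , left ,
     consecutive-tops-hit U aba int A∈U left top-r′ leastTop before lastTop

-- Complementing the ABA-free family

∁-involutive : (p : Subset n) → ∁ (∁ p) ≡ p
∁-involutive {n} = ¬-involutive (∪-∩-booleanAlgebra n)

-- Complementing both sets exchanges their two differences, so a forbidden pattern for `∁ A` and
-- `∁ B` is one for `B` and `A`.
ABA-free-∁ : {F : List (Subset n)} → ABA-free F → ABA-free (map ∁ F)
ABA-free-∁ aba _ _ A∈ B∈ x y z x<y y<z ((x∈A , x∉B) , (z∈A , z∉B) , (y∈B , y∉A))
  with L.∈-map⁻ ∁ A∈ | L.∈-map⁻ ∁ B∈
... | A , A∈F , refl | B , B∈F , refl =
  aba B A B∈F A∈F x y z x<y y<z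
    ( (x∉∁p⇒x∈p x∉B , x∈∁p⇒x∉p x∈A)
    , (x∉∁p⇒x∈p z∉B , x∈∁p⇒x∉p z∈A)
    , (x∉∁p⇒x∈p y∉A , x∈∁p⇒x∉p y∈B))

SubFamilyWithComplements-∁ : {H F : List (Subset n)} →
  SubFamilyWithComplements H F → SubFamilyWithComplements H (map ∁ F)
SubFamilyWithComplements-∁ sub E E∈H with sub E E∈H
... | inj₁ E∈F = inj₂ (∁ E , L.∈-map⁺ ∁ E∈F , sym (∁-involutive E))
... | inj₂ (G , G∈F , refl) = inj₁ (L.∈-map⁺ ∁ G∈F)

-- Hitting sets from three vertices

∣p∪q∣≤∣p∣+∣q∣ : (p q : Subset n) → ∣ p ∪ q ∣ ≤ ∣ p ∣ + ∣ q ∣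
∣p∪q∣≤∣p∣+∣q∣ [] [] = z≤n
∣p∪q∣≤∣p∣+∣q∣ (false ∷ p) (false ∷ q) = ∣p∪q∣≤∣p∣+∣q∣ p q
∣p∪q∣≤∣p∣+∣q∣ (false ∷ p) (true ∷ q) =
  ℕ.≤-trans (s≤s (∣p∪q∣≤∣p∣+∣q∣ p q)) (ℕ.≤-reflexive (sym (ℕ.+-suc ∣ p ∣ ∣ q ∣)))
∣p∪q∣≤∣p∣+∣q∣ (true ∷ p) (false ∷ q) = s≤s (∣p∪q∣≤∣p∣+∣q∣ p q)
∣p∪q∣≤∣p∣+∣q∣ (true ∷ p) (true ∷ q) =
  s≤s (ℕ.≤-trans (∣p∪q∣≤∣p∣+∣q∣ p q) (ℕ.+-monoʳ-≤ ∣ p ∣ (ℕ.n≤1+n ∣ q ∣)))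

-- The vertices may coincide, so this also serves when two points suffice.
hits-by-three : (H : List (Subset n)) (x y z : Fin n) →
  (∀ E → E L.∈ H → x ∈ E ⊎ y ∈ E ⊎ z ∈ E) → ∃[ S ] (∣ S ∣ ≤ 3 × Hits S H)
hits-by-three H x y z hit = S , size , hits
  where
  S = ⁅ x ⁆ ∪ (⁅ y ⁆ ∪ ⁅ z ⁆)

  size : ∣ S ∣ ≤ 3
  size = begin
    ∣ S ∣                                   ≤⟨ ∣p∪q∣≤∣p∣+∣q∣ ⁅ x ⁆ _ ⟩
    ∣ ⁅ x ⁆ ∣ + ∣ ⁅ y ⁆ ∪ ⁅ z ⁆ ∣           ≤⟨ ℕ.+-monoʳ-≤ ∣ ⁅ x ⁆ ∣ (∣p∪q∣≤∣p∣+∣q∣ ⁅ y ⁆ ⁅ z ⁆) ⟩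
    ∣ ⁅ x ⁆ ∣ + (∣ ⁅ y ⁆ ∣ + ∣ ⁅ z ⁆ ∣)     ≡⟨ singletons ⟩
    3                                       ∎
    where
    open ℕ.≤-Reasoning
    singletons : ∣ ⁅ x ⁆ ∣ + (∣ ⁅ y ⁆ ∣ + ∣ ⁅ z ⁆ ∣) ≡ 3
    singletons rewrite ∣⁅x⁆∣≡1 x | ∣⁅x⁆∣≡1 y | ∣⁅x⁆∣≡1 z = refl

  hits : Hits S H
  hits E E∈H with hit E E∈H
  ... | inj₁ x∈E = x , x∈p∩q⁺ (x∈p∪q⁺ (inj₁ (x∈⁅x⁆ x)) , x∈E)
  ... | inj₂ (inj₁ y∈E) = y , x∈p∩q⁺ (x∈p∪q⁺ (inj₂ (x∈p∪q⁺ (inj₁ (x∈⁅x⁆ y)))) , y∈E)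
  ... | inj₂ (inj₂ z∈E) = z , x∈p∩q⁺ (x∈p∪q⁺ (inj₂ (x∈p∪q⁺ (inj₂ (x∈⁅x⁆ z)))) , z∈E)

-- Hyperedges avoiding the first vertex

record UpperAvoidingZero (H F U : List (Subset (suc n))) : Set where
  field
    ∈⁺ : ∀ {E} → E L.∈ H → E L.∈ F → Fin.zero ∉ E → E L.∈ U
    ∈⁻ : ∀ {E} → E L.∈ U → E L.∈ H × E L.∈ F × Fin.zero ∉ E

upperAvoidingZero : (H F : List (Subset (suc n))) → ∃[ U ] UpperAvoidingZero H F U
upperAvoidingZero {n} H F = filter P? H , record
  { ∈⁺ = λ E∈H E∈F 0∉E → L.∈-filter⁺ P? E∈H (E∈F , 0∉E)
  ; ∈⁻ = L.∈-filter⁻ P?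
  }
  where
  open DecMembership (Vec.≡-dec {n = suc n} Bool._≟_) using () renaming (_∈?_ to _L∈?_)
  P? : Decidable (λ E → E L.∈ F × Fin.zero ∉ E)
  P? E = (E L∈? F) ×-dec ¬? (Fin.zero ∈? E)

module _ {H F U : List (Subset (suc n))} (aba : ABA-free F)
  (sub : SubFamilyWithComplements H F) (int : Intersecting H)
  (upper : UpperAvoidingZero H F U) where

  open UpperAvoidingZero upper

  hits-by-upper-points : ∀ {A r r′} → A L.∈ U → LeftOf A r′ →
    (∀ C → C L.∈ U → r ∈ C ⊎ r′ ∈ C) →
    ∀ E → E L.∈ H → Fin.zero ∈ E ⊎ r ∈ E ⊎ r′ ∈ E
  hits-by-upper-points {A} {r} {r′} A∈U left hitU E E∈H with ∈⁻ A∈U | Fin.zero ∈? E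
  ... | _ | yes 0∈E = inj₁ 0∈E
  ... | A∈H , A∈F , 0∉A | no 0∉E with sub E E∈H
  ... | inj₁ E∈F = inj₂ (hitU E (∈⁺ E∈H E∈F 0∉E))
  ... | inj₂ (B , B∈F , refl) with int A E A∈H E∈H
  ... | v , v∈A∩E with x∈p∩q⁻ A E v∈A∩E
  ... | v∈A , v∈E = inj₂ (inj₂ (x∉p⇒x∈∁p λ r′∈B →
    aba B A B∈F A∈F Fin.zero v r′ (zero≢⇒zero< (∈∉⇒≢ v∈A 0∉A ∘ sym)) (left v v∈A)
      ( (x∉∁p⇒x∈p 0∉E , 0∉A)
      , (r′∈B , λ r′∈A → ℕ.<-irrefl refl (left r′ r′∈A))
      , (v∈A , x∈∁p⇒x∉p v∈E))))

  -- An alternative rather than a hitting set: it is applied to `F` and to `map ∁ F`, and the second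
  -- outcome is useful only when it occurs for both.
  three-points-or-all-last :
    (∃[ S ] (∣ S ∣ ≤ 3 × Hits S H)) ⊎ (∀ E → E L.∈ U → fromℕ n ∈ E)
  three-points-or-all-last with Any.any? (λ E → ¬? (fromℕ n ∈? E)) U
  ... | no none = inj₂ λ E E∈U → decidable-stable (fromℕ n ∈? E) λ last∉E →
    none (L.lose E∈U last∉E)
  ... | yes some =
    let
      A₀ , A₀∈U , last∉A₀ = L.find some
      U-aba = λ A B A∈U B∈U → aba A B (proj₁ (proj₂ (∈⁻ A∈U))) (proj₁ (proj₂ (∈⁻ B∈U)))
      U-int = λ A B A∈U B∈U → int A B (proj₁ (∈⁻ A∈U)) (proj₁ (∈⁻ B∈U))
      A , r , r′ , A∈U , left , hitU = two-points U U-aba U-int A₀∈U last∉A₀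
    in inj₁ (hits-by-three H Fin.zero r r′ (hits-by-upper-points A∈U left hitU))

mainTheorem3 : (n : ℕ) (H : List (Subset n)) →
    IsPseudohalfplane H → Intersecting H →
    ∃[ S ] (∣ S ∣ ≤ 3 × Hits S H)
-- Without vertices no hyperedge can meet itself, so `H` is empty.
mainTheorem3 zero H _ int = ⊥ , z≤n , λ E E∈H → case int E E E∈H E∈H of λ { (() , _) }
mainTheorem3 (suc n) H (F , aba , sub) int =
  let
    U , upper = upperAvoidingZero H F
    U′ , upper′ = upperAvoidingZero H (map ∁ F)
  in combine upper upper′
       (three-points-or-all-last aba sub int upper)
       (three-points-or-all-last (ABA-free-∁ aba) (SubFamilyWithComplements-∁ sub) int upper′)
  where
  combine : ∀ {U U′} → UpperAvoidingZero H F U → UpperAvoidingZero H (map ∁ F) U′ →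
    (∃[ S ] (∣ S ∣ ≤ 3 × Hits S H)) ⊎ (∀ E → E L.∈ U → fromℕ n ∈ E) →
    (∃[ S ] (∣ S ∣ ≤ 3 × Hits S H)) ⊎ (∀ E → E L.∈ U′ → fromℕ n ∈ E) →
    ∃[ S ] (∣ S ∣ ≤ 3 × Hits S H)
  combine _ _ (inj₁ found) _ = found
  combine _ _ (inj₂ _) (inj₁ found) = found
  combine upper upper′ (inj₂ lastU) (inj₂ lastU′) =
    -- Each hyperedge lies in `F` or in `map ∁ F`; if it avoids the first vertex, it belongs to `U`
    -- or `U′` and contains the last one.
    hits-by-three H Fin.zero Fin.zero (fromℕ n) hit
    where
    open UpperAvoidingZero
    hit : ∀ E → E L.∈ H → Fin.zero ∈ E ⊎ Fin.zero ∈ E ⊎ fromℕ n ∈ E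
    hit E E∈H with Fin.zero ∈? E
    ... | yes 0∈E = inj₁ 0∈E
    ... | no 0∉E with sub E E∈H
    ... | inj₁ E∈F = inj₂ (inj₂ (lastU E (∈⁺ upper E∈H E∈F 0∉E)))
    ... | inj₂ (G , G∈F , refl) =
      inj₂ (inj₂ (lastU′ E (∈⁺ upper′ E∈H (L.∈-map⁺ ∁ G∈F) 0∉E)))
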